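{- Let $0<p\le 1$ with $p\ne\frac12$, let $q=1-p$, and let $X_{n,s}$ be the number of turns required to end the single-player pile game with boundary with set of choices $R=\{1,-1\}$ and target $n$, starting with $s$ chips, $0\le s\le n$. Then $$E[X_{n,s}]=\frac{(2p-1)n+q\left(\frac{q}{p}\right)^n-\left[(2p-1)s+q\left(\frac{q}{p}\right)^s\right]}{(2p-1)^2}.$$
   Context: Single-player pile game with boundary, $R=\{1,-1\}$: the player starts with $s$ chips, $0\le s\le n$. In each turn, independently, with probability $p$ one chip is added, and with probability $q=1-p$ one chip is removed, except that if the player has $0$ chips he stays at $0$ instead. The game ends when the player first has $n$ chips (at turn $0$ if $s=n$). -}

module Defs where

open import Level using (_⊔_) renaming (suc to lsuc)
open import Algebra.Apartness.Bundles
  using (HeytingCommutativeRing; HeytingField)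
open import Algebra.Bundles using (CommutativeRing; Semiring)
import Algebra.Apartness.Properties.HeytingCommutativeRing as HeytingProperties
import Algebra.Definitions.RawSemiring as RawSemiringDefinitions
import Algebra.Properties.Ring as RingProperties
open import Data.Empty using (⊥-elim)
open import Data.List.Base using (List; []; _∷_; _++_; map; filter; foldr)
open import Data.Nat.Base as ℕ using (ℕ; zero; suc; pred)
open import Data.Nat.Properties using (_≟_)
open import Data.Product.Base using (∃-syntax; _×_; _,_; proj₁)
open import Data.Sum.Base using (_⊎_; inj₁; inj₂)
open import Data.Vec.Base using (Vec; []; _∷_)
open import Function.Bundles using (_⇔_; Equivalence)
open import Relation.Binary.Core using (Rel)
open import Relation.Binary.PropositionalEquality using (_≡_; _≢_)
open import Relation.Binary.Structures using (IsStrictPartialOrder)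
import Relation.Binary.Reasoning.Setoid as SetoidReasoning
open import Relation.Nullary using (¬_; Dec; ¬?)
open import Relation.Nullary.Decidable using (_×-dec_)

-- The real numbers are axiomatised as a Cauchy-complete archimedean ordered
-- field.  The axioms are the constructive ones: `x # y` plays the role of
-- `x ≠ y` (and coincides with it classically), and trichotomy is not assumed.

record OrderedField c ℓ₁ ℓ₂ ℓ₃ : Set (lsuc (c ⊔ ℓ₁ ⊔ ℓ₂ ⊔ ℓ₃)) where
  infix 4 _<_
  field
    heytingField : HeytingField c ℓ₁ ℓ₂

  open HeytingField heytingField public

  field
    _<_                  : Rel Carrier ℓ₃
    isStrictPartialOrder : IsStrictPartialOrder _≈_ _<_
    #⇔<⊎>                : ∀ {x y} → (x # y) ⇔ (x < y ⊎ y < x)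
    +-monoʳ-<            : ∀ x {y z} → y < z → (x + y) < (x + z)
    *-pos                : ∀ {x y} → 0# < x → 0# < y → 0# < (x * y)

  open IsStrictPartialOrder isStrictPartialOrder public
    using (<-respʳ-≈; <-respˡ-≈; <-resp-≈)
    renaming (irrefl to <-irrefl; trans to <-trans; asym to <-asym)

  commutativeRing : CommutativeRing c ℓ₁
  commutativeRing =
    HeytingCommutativeRing.commutativeRing heytingCommutativeRing

  open CommutativeRing commutativeRing public
    using (ring; semiring)

  open RawSemiringDefinitions (Semiring.rawSemiring semiring) public
    using (_^_) renaming (_×_ to _·_)

  infix 4 _≤_
  _≤_ : Rel Carrier ℓ₃
  x ≤ y = ¬ (y < x)

  fromℕ : ℕ → Carrier
  fromℕ n = n · 1#

  2# : Carrier
  2# = fromℕ 2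

  -- `#⇒invertible y#0` provides an inverse of `y - 0#`.
  infixl 7 _/_[_]
  _/_[_] : (x y : Carrier) → y # 0# → Carrier
  x / y [ y#0 ] = x * proj₁ (#⇒invertible y#0)

  infix 4 _isWithin_of_
  _isWithin_of_ : (x ε y : Carrier) → Set ℓ₃
  x isWithin ε of y = (- ε < x - y) × (x - y < ε)

  infix 4 _⟶_
  _⟶_ : (ℕ → Carrier) → Carrier → Set (c ⊔ ℓ₃)
  u ⟶ l = ∀ ε → 0# < ε → ∃[ N ] ∀ m → N ℕ.≤ m → u m isWithin ε of l

  IsCauchy : (ℕ → Carrier) → Set (c ⊔ ℓ₃)
  IsCauchy u = ∀ ε → 0# < ε →
    ∃[ N ] ∀ k m → N ℕ.≤ k → N ℕ.≤ m → u k isWithin ε of u m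

  ∑< : ℕ → (ℕ → Carrier) → Carrier
  ∑< zero    u = 0#
  ∑< (suc m) u = ∑< m u + u m

  HasSum : (ℕ → Carrier) → Carrier → Set (c ⊔ ℓ₃)
  HasSum u l = (λ m → ∑< m u) ⟶ l

record RealField c ℓ₁ ℓ₂ ℓ₃ : Set (lsuc (c ⊔ ℓ₁ ⊔ ℓ₂ ⊔ ℓ₃)) where
  field
    orderedField : OrderedField c ℓ₁ ℓ₂ ℓ₃

  open OrderedField orderedField public

  field
    archimedean : ∀ x → ∃[ N ] x < fromℕ N
    complete    : ∀ u → IsCauchy u → ∃[ l ] u ⟶ l

data Choice : Set where
  add remove : Choice

move : ℕ → Choice → ℕ
move k add    = suc k
move k remove = pred k

-- `EndsAfter n s ω`: starting with s chips and making the successive choices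
-- ω, the player has n chips after all of them, and not after any proper
-- initial segment of them.

EndsAfter : ℕ → ℕ → ∀ {t} → Vec Choice t → Set
EndsAfter n s []      = s ≡ n
EndsAfter n s (r ∷ ω) = s ≢ n × EndsAfter n (move s r) ω

endsAfter? : ∀ n s {t} (ω : Vec Choice t) → Dec (EndsAfter n s ω)
endsAfter? n s []      = s ≟ n
endsAfter? n s (r ∷ ω) = ¬? (s ≟ n) ×-dec endsAfter? n (move s r) ω

choiceSequences : ∀ t → List (Vec Choice t)
choiceSequences zero    = [] ∷ []
choiceSequences (suc t) =
  map (add ∷_) (choiceSequences t) ++ map (remove ∷_) (choiceSequences t)

module _ {c ℓ₁ ℓ₂ ℓ₃} (ℝ : RealField c ℓ₁ ℓ₂ ℓ₃) where
  open RealField ℝ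
  open HeytingProperties heytingCommutativeRing
  open RingProperties ring

  private
    0<1 : 0# < 1#
    0<1 with Equivalence.to #⇔<⊎> 1#0
    ... | inj₂ 0<1 = 0<1
    ... | inj₁ 1<0 = ⊥-elim (<-asym 1<0 (<-respʳ-≈ -1*-1≈1 (*-pos 0<-1 0<-1)))
      where
      0<-1 : 0# < - 1#
      0<-1 = <-respˡ-≈ (-‿inverseˡ 1#)
               (<-respʳ-≈ (+-identityʳ (- 1#)) (+-monoʳ-< (- 1#) 1<0))

      -1*-1≈1 : - 1# * - 1# ≈ 1#
      -1*-1≈1 = trans (-1*x≈-x (- 1#)) (-‿involutive 1#)

    2≈1+1 : 2# ≈ 1# + 1#
    2≈1+1 = +-congˡ (+-identityʳ 1#)

  0<⇒#0 : ∀ {x} → 0# < x → x # 0#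
  0<⇒#0 0<x = Equivalence.from #⇔<⊎> (inj₂ 0<x)

  2#0 : 2# # 0#
  2#0 = 0<⇒#0 (<-respʳ-≈ (sym 2≈1+1) (<-trans 0<1
          (<-respˡ-≈ (+-identityʳ 1#) (+-monoʳ-< 1# 0<1))))

  ½ : Carrier
  ½ = 1# / 2# [ 2#0 ]

  [2p-1]²#0 : ∀ {p} → p # ½ → (2# * p - 1#) ^ 2 # 0#
  [2p-1]²#0 {p} p#½ = #-congʳ (*-congˡ (sym (*-identityʳ _)))
                        (x#0y#0→xy#0 2p-1#0 2p-1#0)
    where
    open SetoidReasoning setoid

    p-½#0 : p - ½ # 0#
    p-½#0 with #⇒invertible p#½
    ... | i , i*[p-½]≈1 , _ =
      invertibleˡ⇒# (i , trans (*-congˡ (x-0≈x _)) i*[p-½]≈1)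

    2*½≈1 : 2# * ½ ≈ 1#
    2*½≈1 with #⇒invertible 2#0
    ... | i , _ , [2-0]*i≈1 = begin
      2# * (1# * i)   ≈⟨ *-congˡ (*-identityˡ i) ⟩
      2# * i          ≈⟨ *-congʳ (x-0≈x 2#) ⟨
      (2# - 0#) * i   ≈⟨ [2-0]*i≈1 ⟩
      1#              ∎

    2p-1#0 : 2# * p - 1# # 0#
    2p-1#0 = #-congʳ (begin
      2# * (p - ½)           ≈⟨ distribˡ 2# p (- ½) ⟩
      2# * p + 2# * - ½      ≈⟨ +-congˡ (-‿distribʳ-* 2# ½) ⟨
      2# * p - 2# * ½        ≈⟨ +-congˡ (-‿cong 2*½≈1) ⟩
      2# * p - 1#            ∎) (x#0y#0→xy#0 2#0 p-½#0)

  -- The event {X = t} depends only on the first t choices, so its probability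
  -- under infinitely many independent choices is the total weight of the
  -- sequences of t choices for which it occurs.

  choiceProbability : Carrier → Choice → Carrier
  choiceProbability p add    = p
  choiceProbability p remove = 1# - p

  weight : Carrier → ∀ {t} → Vec Choice t → Carrier
  weight p []      = 1#
  weight p (r ∷ ω) = choiceProbability p r * weight p ω

  ℙ[X≡_] : (t : ℕ) (p : Carrier) (n s : ℕ) → Carrier
  ℙ[X≡ t ] p n s =
    foldr _+_ 0# (map (weight p) (filter (endsAfter? n s) (choiceSequences t)))

  -- A random variable with values in ℕ ∪ {∞} and probabilities f t of the
  -- finite values t has the real number e as expectation iff it is almost
  -- surely finite and ∑ t · f t converges to e.

  record IsExpectation (f : ℕ → Carrier) (e : Carrier) : Set (c ⊔ ℓ₃) where
    field
      finite : HasSum f 1#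
      mean   : HasSum (λ t → fromℕ t * f t) e

{-# OPTIONS --safe #-}
module Submission where

-- Let P be the transition operator of the walk killed at n, so that
-- ℙ(X = t + 1) = P ℙ(X = t) and ℙ(X > m) = P ℙ(X ≥ m) as functions of the
-- starting point.  A nonnegative solution e of e = P 1 + P e controls both
-- series at once: induction on m gives m ℙ(X ≥ m) ≤ e, and then, if e ≤ K,
-- m E[X; X ≥ m] ≤ 2 K e.  So both tails are O(1/m) and e = E[X].  The closed
-- form solves the first-step equations and vanishes at n; the equations make
-- it antitone in s, hence nonnegative and bounded by its value at 0.

open import Defs
open import Algebra.Bundles using (CommutativeRing)
import Algebra.Apartness.Properties.HeytingCommutativeRing as HeytingProperties
import Algebra.Properties.Ring as RingProperties
import Algebra.Solver.Ring.NaturalCoefficients.Default as SemiringSolver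
open import Data.Bool.Base using (true; false)
open import Data.Empty using (⊥-elim)
open import Data.List.Base using (List; []; _∷_; _++_; map; filter; foldr)
open import Data.List.Properties using (filter-++; filter-accept; filter-none;
  filter-reject; filter-≐)
import Data.List.Relation.Unary.All as All
import Data.List.Relation.Unary.All.Properties as All
open import Data.Nat.Base as ℕ using (ℕ; zero; suc; pred; z≤n; s≤s)
import Data.Nat.Properties as ℕ
open import Data.Product.Base using (_,_; proj₁; proj₂)
open import Data.Sum.Base using (_⊎_; inj₁; inj₂)
open import Data.Vec.Base using (Vec; []; _∷_)
open import Function.Base using (_∘_)
open import Function.Bundles using (Equivalence)
open import Relation.Binary.Definitions using (Trans; Transitive)
import Relation.Binary.PropositionalEquality as ≡
open ≡ using (_≡_; _≢_)
open import Relation.Binary.Structures using (IsPreorder)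
import Relation.Binary.Reasoning.Base.Triple as TripleReasoning
open import Relation.Nullary using (yes; no; does)
open import Relation.Unary using (Pred; Decidable)

filter-map : ∀ {a b p} {A : Set a} {B : Set b} {Q : Pred B p}
  (Q? : Decidable Q) (f : A → B) xs →
  filter Q? (map f xs) ≡ map f (filter (Q? ∘ f) xs)
filter-map Q? f []       = ≡.refl
filter-map Q? f (x ∷ xs) with does (Q? (f x))
... | true  = ≡.cong (f x ∷_) (filter-map Q? f xs)
... | false = filter-map Q? f xs

-- Order and sign rules without trichotomy.

module OrderedFieldProperties {c ℓ₁ ℓ₂ ℓ₃} (F : OrderedField c ℓ₁ ℓ₂ ℓ₃) where
  open OrderedField F
  open HeytingProperties heytingCommutativeRing using (1#0; x-0≈x; invertibleˡ⇒#)
  open RingProperties ring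
  open SemiringSolver (CommutativeRing.commutativeSemiring commutativeRing)
    using (solve; _:=_; _:+_)

  -- Stands in for trichotomy. Cotransitivity of `#` separates `z` from one endpoint; if `z` then
  -- lies outside the interval, transitivity compares it with the other endpoint.
  <-cotrans : ∀ {x y} → x < y → ∀ z → x < z ⊎ z < y
  <-cotrans x<y z with #-cotrans (Equivalence.from #⇔<⊎> (inj₁ x<y)) z
  ... | inj₁ x#z with Equivalence.to #⇔<⊎> x#z
  ...   | inj₁ x<z = inj₁ x<z
  ...   | inj₂ z<x = inj₂ (<-trans z<x x<y)
  <-cotrans x<y z | inj₂ z#y with Equivalence.to #⇔<⊎> z#y
  ...   | inj₁ z<y = inj₂ z<y
  ...   | inj₂ y<z = inj₁ (<-trans x<y y<z)

  ≈⇒≤ : ∀ {x y} → x ≈ y → x ≤ y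
  ≈⇒≤ x≈y y<x = <-irrefl (sym x≈y) y<x

  ≤-refl : ∀ {x} → x ≤ x
  ≤-refl = ≈⇒≤ refl

  <⇒≤ : ∀ {x y} → x < y → x ≤ y
  <⇒≤ = <-asym

  ≤-trans : Transitive _≤_
  ≤-trans {x} {y} x≤y y≤z z<x with <-cotrans z<x y
  ... | inj₁ z<y = y≤z z<y
  ... | inj₂ y<x = x≤y y<x

  <-≤-trans : Trans _<_ _≤_ _<_
  <-≤-trans {x} {y} {z} x<y y≤z with <-cotrans x<y z
  ... | inj₁ x<z = x<z
  ... | inj₂ z<y = ⊥-elim (y≤z z<y)

  ≤-<-trans : Trans _≤_ _<_ _<_
  ≤-<-trans {x} {y} {z} x≤y y<z with <-cotrans y<z x
  ... | inj₁ y<x = ⊥-elim (x≤y y<x)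
  ... | inj₂ x<z = x<z

  ≤-isPreorder : IsPreorder _≈_ _≤_
  ≤-isPreorder = record
    { isEquivalence = isEquivalence ; reflexive = ≈⇒≤ ; trans = ≤-trans }

  module ≤-Reasoning =
    TripleReasoning ≤-isPreorder <-asym <-trans <-resp-≈ <⇒≤ <-≤-trans ≤-<-trans
  open ≤-Reasoning

  -x+[x+y]≈y : ∀ x y → - x + (x + y) ≈ y
  -x+[x+y]≈y x y = begin-equality
    - x + (x + y)  ≈⟨ +-assoc (- x) x y ⟨
    - x + x + y    ≈⟨ +-congʳ (-‿inverseˡ x) ⟩
    0# + y         ≈⟨ +-identityˡ y ⟩
    y              ∎

  +-cancelˡ-< : ∀ x {y z} → x + y < x + z → y < z
  +-cancelˡ-< x {y} {z} x+y<x+z = begin-strict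
    y              ≈⟨ -x+[x+y]≈y x y ⟨
    - x + (x + y)  <⟨ +-monoʳ-< (- x) x+y<x+z ⟩
    - x + (x + z)  ≈⟨ -x+[x+y]≈y x z ⟩
    z              ∎

  +-monoʳ-≤ : ∀ x {y z} → y ≤ z → x + y ≤ x + z
  +-monoʳ-≤ x y≤z x+z<x+y = y≤z (+-cancelˡ-< x x+z<x+y)

  +-cancelˡ-≤ : ∀ x {y z} → x + y ≤ x + z → y ≤ z
  +-cancelˡ-≤ x x+y≤x+z z<y = x+y≤x+z (+-monoʳ-< x z<y)

  +-mono-≤ : ∀ {w x y z} → w ≤ x → y ≤ z → w + y ≤ x + z
  +-mono-≤ {w} {x} {y} {z} w≤x y≤z = begin
    w + y  ≤⟨ +-monoʳ-≤ w y≤z ⟩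
    w + z  ≈⟨ +-comm w z ⟩
    z + w  ≤⟨ +-monoʳ-≤ z w≤x ⟩
    z + x  ≈⟨ +-comm z x ⟩
    x + z  ∎

  0≤+ : ∀ {x y} → 0# ≤ x → 0# ≤ y → 0# ≤ x + y
  0≤+ 0≤x 0≤y = ≤-trans (≈⇒≤ (sym (+-identityˡ 0#))) (+-mono-≤ 0≤x 0≤y)

  x+[y-x]≈y : ∀ x y → x + (y - x) ≈ y
  x+[y-x]≈y x y = begin-equality
    x + (y - x)    ≈⟨ solve 3 (λ x y z → x :+ (y :+ z) := (x :+ z) :+ y) refl x y (- x) ⟩
    x - x + y      ≈⟨ +-congʳ (-‿inverseʳ x) ⟩
    0# + y         ≈⟨ +-identityˡ y ⟩
    y              ∎

  x<y⇒0<y-x : ∀ {x y} → x < y → 0# < y - x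
  x<y⇒0<y-x {x} {y} x<y = +-cancelˡ-< x (begin-strict
    x + 0#       ≈⟨ +-identityʳ x ⟩
    x            <⟨ x<y ⟩
    y            ≈⟨ x+[y-x]≈y x y ⟨
    x + (y - x)  ∎)

  x≤y⇒0≤y-x : ∀ {x y} → x ≤ y → 0# ≤ y - x
  x≤y⇒0≤y-x {x} {y} x≤y = +-cancelˡ-≤ x (begin
    x + 0#       ≈⟨ +-identityʳ x ⟩
    x            ≤⟨ x≤y ⟩
    y            ≈⟨ x+[y-x]≈y x y ⟨
    x + (y - x)  ∎)

  neg-antimono-< : ∀ {x y} → x < y → - y < - x
  neg-antimono-< {x} {y} x<y = +-cancelˡ-< y (begin-strict
    y - y  ≈⟨ -‿inverseʳ y ⟩
    0#     <⟨ x<y⇒0<y-x x<y ⟩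
    y - x  ∎)

  0<1 : 0# < 1#
  0<1 with Equivalence.to #⇔<⊎> 1#0
  ... | inj₂ 0<1 = 0<1
  ... | inj₁ 1<0 = ⊥-elim (<-asym 1<0 (begin-strict
    0#           <⟨ *-pos 0<-1 0<-1 ⟩
    - 1# * - 1#  ≈⟨ trans (-1*x≈-x (- 1#)) (-‿involutive 1#) ⟩
    1#           ∎))
    where
    0<-1 : 0# < - 1#
    0<-1 = <-respˡ-≈ -0#≈0# (neg-antimono-< 1<0)

  *-distribˡ-- : ∀ x y z → x * (y - z) ≈ x * y - x * z
  *-distribˡ-- x y z =
    trans (distribˡ x y (- z)) (+-congˡ (sym (-‿distribʳ-* x z)))

  *-monoʳ-< : ∀ {x y z} → 0# < x → y < z → x * y < x * z
  *-monoʳ-< {x} {y} {z} 0<x y<z = begin-strict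
    x * y                    ≈⟨ +-identityʳ (x * y) ⟨
    x * y + 0#               <⟨ +-monoʳ-< (x * y) (*-pos 0<x (x<y⇒0<y-x y<z)) ⟩
    x * y + x * (z - y)      ≈⟨ distribˡ x y (z - y) ⟨
    x * (y + (z - y))        ≈⟨ *-congˡ (x+[y-x]≈y y z) ⟩
    x * z                    ∎

  *-cancelˡ-≤ : ∀ {x y z} → 0# < x → x * y ≤ x * z → y ≤ z
  *-cancelˡ-≤ 0<x xy≤xz z<y = xy≤xz (*-monoʳ-< 0<x z<y)

  -- An inverse `i` of `x * y - x * z` makes `i * x` an inverse of `y - z`, whatever the sign of
  -- `x`.
  *-cancelˡ-# : ∀ x {y z} → x * y # x * z → y # z
  *-cancelˡ-# x {y} {z} xy#xz with #⇒invertible xy#xz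
  ... | i , i*[xy-xz]≈1 , _ = invertibleˡ⇒# (i * x , (begin-equality
    i * x * (y - z)      ≈⟨ *-assoc i x (y - z) ⟩
    i * (x * (y - z))    ≈⟨ *-congˡ (*-distribˡ-- x y z) ⟩
    i * (x * y - x * z)  ≈⟨ i*[xy-xz]≈1 ⟩
    1#                   ∎))

  xy#0⇒0<y : ∀ {x y} → 0# ≤ y → x * y # 0# → 0# < y
  xy#0⇒0<y {x} {y} 0≤y xy#0
    with Equivalence.to #⇔<⊎>
           (*-cancelˡ-# x (#-sym (HeytingProperties.#-congʳ heytingCommutativeRing
             (sym (zeroʳ x)) (#-sym xy#0))))
  ... | inj₁ y<0 = ⊥-elim (0≤y y<0)
  ... | inj₂ 0<y = 0<y

  -- Constructively a nonnegative number cannot be split into zero or positive. The claim is a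
  -- negation, though: if `x * y < 0#`, the product is apart from 0, hence both factors are
  -- positive, and so is their product.
  0≤* : ∀ {x y} → 0# ≤ x → 0# ≤ y → 0# ≤ x * y
  0≤* {x} {y} 0≤x 0≤y xy<0 =
    <-asym xy<0 (*-pos (xy#0⇒0<y 0≤x yx#0) (xy#0⇒0<y 0≤y xy#0))
    where
    xy#0 : x * y # 0#
    xy#0 = Equivalence.from #⇔<⊎> (inj₁ xy<0)

    yx#0 : y * x # 0#
    yx#0 = Equivalence.from #⇔<⊎> (inj₁ (<-respˡ-≈ (*-comm x y) xy<0))

  *-monoʳ-≤ : ∀ {x y z} → 0# ≤ x → y ≤ z → x * y ≤ x * z
  *-monoʳ-≤ {x} {y} {z} 0≤x y≤z = begin
    x * y                    ≈⟨ +-identityʳ (x * y) ⟨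
    x * y + 0#               ≤⟨ +-monoʳ-≤ (x * y) (0≤* 0≤x (x≤y⇒0≤y-x y≤z)) ⟩
    x * y + x * (z - y)      ≈⟨ distribˡ x y (z - y) ⟨
    x * (y + (z - y))        ≈⟨ *-congˡ (x+[y-x]≈y y z) ⟩
    x * z                    ∎

  -- Strict inequality of the products already forces `y # z`, and monotonicity excludes `z < y`.
  -- This covers `x = fromℕ m` for every `m`.
  *-cancelˡ-< : ∀ {x y z} → 0# ≤ x → x * y < x * z → y < z
  *-cancelˡ-< {x} 0≤x xy<xz
    with Equivalence.to #⇔<⊎> (*-cancelˡ-# x (Equivalence.from #⇔<⊎> (inj₁ xy<xz)))
  ... | inj₁ y<z = y<z
  ... | inj₂ z<y = ⊥-elim (*-monoʳ-≤ 0≤x (<⇒≤ z<y) xy<xz)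

  0≤fromℕ : ∀ n → 0# ≤ fromℕ n
  0≤fromℕ zero    = ≤-refl
  0≤fromℕ (suc n) = 0≤+ (<⇒≤ 0<1) (0≤fromℕ n)

  fromℕ-mono-≤ : ∀ {m n} → m ℕ.≤ n → fromℕ m ≤ fromℕ n
  fromℕ-mono-≤ {n = n} z≤n = 0≤fromℕ n
  fromℕ-mono-≤ (s≤s m≤n)   = +-monoʳ-≤ 1# (fromℕ-mono-≤ m≤n)

-- Convergence from a bound on the remainder.

module RealFieldProperties {c ℓ₁ ℓ₂ ℓ₃} (ℝ : RealField c ℓ₁ ℓ₂ ℓ₃) where
  open RealField ℝ
  open HeytingProperties heytingCommutativeRing using (x-0≈x)
  open RingProperties ring
  open OrderedFieldProperties orderedField public
  open ≤-Reasoning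
  open SemiringSolver (CommutativeRing.commutativeSemiring commutativeRing)
    using (solve; _:=_; _:*_)

  -- `x m` is the remainder `l - u m`. It is nonnegative, so only the bound `x m < ε` takes work.
  ⟶-from-O[1/m] : ∀ {u : ℕ → Carrier} {l} (x : ℕ → Carrier) C →
    (∀ m → u m + x m ≈ l) → (∀ m → 0# ≤ x m) → (∀ m → fromℕ m * x m ≤ C) →
    u ⟶ l
  ⟶-from-O[1/m] {u} {l} x C u+x≈l 0≤x mx≤C ε 0<ε
    with #⇒invertible (0<⇒#0 ℝ 0<ε)
  ... | i , i*ε≈1 , _ with archimedean (C * i)
  -- The archimedean axiom gives an `N` above C/ε. For `m ≥ N` then `m * x m ≤ C < ε * N ≤ ε * m`,
  -- and the factor `m` cancels.
  ... | N , Ci<N = N , λ m N≤m →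
    let x<ε : x m < ε
        x<ε = *-cancelˡ-< (0≤fromℕ m) (begin-strict
          fromℕ m * x m         ≤⟨ mx≤C m ⟩
          C                     ≈⟨ *-identityʳ C ⟨
          C * 1#                ≈⟨ *-congˡ (trans (*-congˡ (sym (x-0≈x ε))) i*ε≈1) ⟨
          C * (i * ε)           ≈⟨ solve 3 (λ C i ε → C :* (i :* ε) := ε :* (C :* i))
                                     refl C i ε ⟩
          ε * (C * i)           <⟨ *-monoʳ-< 0<ε Ci<N ⟩
          ε * fromℕ N           ≤⟨ *-monoʳ-≤ (<⇒≤ 0<ε) (fromℕ-mono-≤ N≤m) ⟩
          ε * fromℕ m           ≈⟨ *-comm ε (fromℕ m) ⟩
          fromℕ m * ε           ∎)

        -x≈u-l : - x m ≈ u m - l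
        -x≈u-l = begin-equality
          - x m                       ≈⟨ +-identityˡ (- x m) ⟨
          0# - x m                    ≈⟨ +-congʳ (-‿inverseʳ (u m)) ⟨
          u m - u m - x m             ≈⟨ +-assoc (u m) (- u m) (- x m) ⟩
          u m + (- u m - x m)         ≈⟨ +-congˡ (-‿+-comm (u m) (x m)) ⟩
          u m - (u m + x m)           ≈⟨ +-congˡ (-‿cong (u+x≈l m)) ⟩
          u m - l                     ∎
    in <-respʳ-≈ -x≈u-l (neg-antimono-< x<ε) , (begin-strict
         u m - l         ≈⟨ -x≈u-l ⟨
         - x m           ≈⟨ +-identityˡ (- x m) ⟨
         0# - x m        ≤⟨ +-mono-≤ (0≤x m) ≤-refl ⟩
         x m - x m       ≈⟨ -‿inverseʳ (x m) ⟩
         0#              <⟨ 0<ε ⟩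
         ε               ∎)

-- The walk killed at its target.

module AbsorbedWalk {c ℓ₁ ℓ₂ ℓ₃} (ℝ : RealField c ℓ₁ ℓ₂ ℓ₃) where
  open RealField ℝ
  open RealFieldProperties ℝ
  open ≤-Reasoning
  open SemiringSolver (CommutativeRing.commutativeSemiring commutativeRing)
    using (solve; _:=_; _:+_; _:*_; con)

  [1+x]*y≈y+x*y : ∀ x y → (1# + x) * y ≈ y + x * y
  [1+x]*y≈y+x*y x y = trans (distribʳ y 1# x) (+-congʳ (*-identityˡ y))

  module Step (p q : Carrier) (p+q≈1 : p + q ≈ 1#) (0≤p : 0# ≤ p) (0≤q : 0# ≤ q) (n : ℕ)
    where

    -- The value 0 at `n` is the killing; `pred 0 = 0` is the rule that a player without chips stays
    -- at 0.
    P : (ℕ → Carrier) → ℕ → Carrier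
    P h s with s ℕ.≟ n
    ... | yes _ = 0#
    ... | no  _ = p * h (suc s) + q * h (pred s)

    -- The range from 0 to `n` is closed under the walk: `P` looks at the neighbours of `s` only if
    -- `s` differs from `n`, and both then lie in the range. So inductions can use facts, such as
    -- the sign of `e`, that are known only there.
    P-mono : ∀ {h k} → (∀ s → s ℕ.≤ n → h s ≤ k s) →
      ∀ s → s ℕ.≤ n → P h s ≤ P k s
    P-mono h≤k s s≤n with s ℕ.≟ n
    ... | yes _   = ≤-refl
    ... | no  s≢n = +-mono-≤
      (*-monoʳ-≤ 0≤p (h≤k (suc s) (ℕ.≤∧≢⇒< s≤n s≢n)))
      (*-monoʳ-≤ 0≤q (h≤k (pred s) (ℕ.≤-trans ℕ.pred[n]≤n s≤n)))

    P-cong : ∀ {h k} → (∀ s → s ℕ.≤ n → h s ≈ k s) →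
      ∀ s → s ℕ.≤ n → P h s ≈ P k s
    P-cong h≈k s s≤n with s ℕ.≟ n
    ... | yes _   = refl
    ... | no  s≢n = +-cong
      (*-congˡ (h≈k (suc s) (ℕ.≤∧≢⇒< s≤n s≢n)))
      (*-congˡ (h≈k (pred s) (ℕ.≤-trans ℕ.pred[n]≤n s≤n)))

    P-+ : ∀ h k s → P (λ s → h s + k s) s ≈ P h s + P k s
    P-+ h k s with s ℕ.≟ n
    ... | yes _ = sym (+-identityʳ 0#)
    ... | no  _ = solve 6
      (λ p q a b a′ b′ →
        p :* (a :+ b) :+ q :* (a′ :+ b′) := (p :* a :+ q :* a′) :+ (p :* b :+ q :* b′))
      refl p q (h (suc s)) (k (suc s)) (h (pred s)) (k (pred s))

    P-* : ∀ x h s → P (λ s → x * h s) s ≈ x * P h s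
    P-* x h s with s ℕ.≟ n
    ... | yes _ = sym (zeroʳ x)
    ... | no  _ = solve 5
      (λ p q x a a′ → p :* (x :* a) :+ q :* (x :* a′) := x :* (p :* a :+ q :* a′))
      refl p q x (h (suc s)) (h (pred s))

    P-0 : ∀ s → P (λ _ → 0#) s ≈ 0#
    P-0 s with s ℕ.≟ n
    ... | yes _ = refl
    ... | no  _ = solve 2 (λ p q → p :* con 0 :+ q :* con 0 := con 0) refl p q

    0≤P : ∀ {h} → (∀ s → s ℕ.≤ n → 0# ≤ h s) → ∀ s → s ℕ.≤ n → 0# ≤ P h s
    0≤P 0≤h s s≤n = ≤-trans (≈⇒≤ (sym (P-0 s))) (P-mono 0≤h s s≤n)

    -- The indicator of `s ≢ n`, because `p + q` is 1; it is the probability that at least one turn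
    -- is played.
    P1 : ℕ → Carrier
    P1 = P (λ _ → 1#)

    p*1+q*1≈1 : p * 1# + q * 1# ≈ 1#
    p*1+q*1≈1 = trans (+-cong (*-identityʳ p) (*-identityʳ q)) p+q≈1

    P1≤1 : ∀ s → P1 s ≤ 1#
    P1≤1 s with s ℕ.≟ n
    ... | yes _ = <⇒≤ 0<1
    ... | no  _ = ≈⇒≤ p*1+q*1≈1

    -- f t s stands for the probability of absorption at time t from s.
    module Expectation
      (f : ℕ → ℕ → Carrier)
      (f-zero : ∀ s → f 0 s + P1 s ≈ 1#)
      (f-suc : ∀ t s → f (suc t) s ≈ P (f t) s)
      (e : ℕ → Carrier)
      (e-step : ∀ s → s ℕ.≤ n → e s ≈ P1 s + P e s)
      (0≤e : ∀ s → s ℕ.≤ n → 0# ≤ e s)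
      (K : Carrier)
      (0≤K : 0# ≤ K)
      (e≤K : ∀ s → s ℕ.≤ n → e s ≤ K * P1 s)
      where

      -- With X the absorption time: T m s = ℙ(X ≥ m), and U m s is the part
      -- of the expectation of X coming from X ≥ m.
      T U : ℕ → ℕ → Carrier
      T zero    s = 1#
      T (suc m) s = P (T m) s
      U zero    s = e s
      U (suc m) s = P (U m) s + T (suc m) s

      -- First-step recursions for the partial sums.

      F M : ℕ → ℕ → Carrier
      F m s = ∑< m (λ t → f t s)
      M m s = ∑< m (λ t → fromℕ t * f t s)

      -- Conditioning on the first turn: absorption at time 0 is split off, and later times shift
      -- down by one through `f-suc` and the additivity of `P`.
      F-suc : ∀ m s → F (suc m) s ≈ f 0 s + P (F m) s
      F-suc zero    s = begin-equality
        0# + f 0 s               ≈⟨ +-comm 0# (f 0 s) ⟩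
        f 0 s + 0#               ≈⟨ +-congˡ (P-0 s) ⟨
        f 0 s + P (λ _ → 0#) s   ∎
      F-suc (suc m) s = begin-equality
        F (suc m) s + f (suc m) s         ≈⟨ +-cong (F-suc m s) (f-suc m s) ⟩
        f 0 s + P (F m) s + P (f m) s     ≈⟨ +-assoc _ _ _ ⟩
        f 0 s + (P (F m) s + P (f m) s)   ≈⟨ +-congˡ (P-+ (F m) (f m) s) ⟨
        f 0 s + P (F (suc m)) s           ∎

      -- Absorption at `t + 1` from `s` is absorption at `t` from the next position. The factor
      -- `t + 1` splits into `t`, which yields `P (M m)`, and 1, which yields `P (F m)`; time 0
      -- contributes nothing.
      M-suc : ∀ m s → M (suc m) s ≈ P (M m) s + P (F m) s
      M-suc zero    s = begin-equality
        0# + 0# * f 0 s                     ≈⟨ +-congˡ (zeroˡ (f 0 s)) ⟩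
        0# + 0#                             ≈⟨ +-cong (P-0 s) (P-0 s) ⟨
        P (λ _ → 0#) s + P (λ _ → 0#) s     ∎
      M-suc (suc m) s = begin-equality
        M (suc m) s + (1# + fromℕ m) * f (suc m) s
          ≈⟨ +-cong (M-suc m s) (*-congˡ (f-suc m s)) ⟩
        P (M m) s + P (F m) s + (1# + fromℕ m) * P (f m) s
          ≈⟨ +-congˡ ([1+x]*y≈y+x*y (fromℕ m) (P (f m) s)) ⟩
        P (M m) s + P (F m) s + (P (f m) s + fromℕ m * P (f m) s)
          ≈⟨ solve 4 (λ a b c d → a :+ b :+ (c :+ d) := (a :+ d) :+ (b :+ c)) refl
               (P (M m) s) (P (F m) s) (P (f m) s) (fromℕ m * P (f m) s) ⟩
        (P (M m) s + fromℕ m * P (f m) s) + (P (F m) s + P (f m) s)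
          ≈⟨ +-congʳ (+-congˡ (P-* (fromℕ m) (f m) s)) ⟨
        (P (M m) s + P (λ s → fromℕ m * f m s) s) + (P (F m) s + P (f m) s)
          ≈⟨ +-cong (P-+ (M m) (λ s → fromℕ m * f m s) s) (P-+ (F m) (f m) s) ⟨
        P (M (suc m)) s + P (F (suc m)) s
          ∎

      F+T≈1 : ∀ m s → s ℕ.≤ n → F m s + T m s ≈ 1#
      F+T≈1 zero    s s≤n = +-identityˡ 1#
      F+T≈1 (suc m) s s≤n = begin-equality
        F (suc m) s + P (T m) s               ≈⟨ +-congʳ (F-suc m s) ⟩
        f 0 s + P (F m) s + P (T m) s         ≈⟨ +-assoc _ _ _ ⟩
        f 0 s + (P (F m) s + P (T m) s)       ≈⟨ +-congˡ (P-+ (F m) (T m) s) ⟨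
        f 0 s + P (λ s → F m s + T m s) s     ≈⟨ +-congˡ (P-cong (F+T≈1 m) s s≤n) ⟩
        f 0 s + P1 s                          ≈⟨ f-zero s ⟩
        1#                                    ∎

      -- `U` follows the recursion of `M` with `T` in place of `F`, so the sums combine to
      -- `P1 + P e`, which is `e`. As `U zero` is `e` by definition, this does not yet make `e` the
      -- mean; the decay of `U` does.
      M+U≈e : ∀ m s → s ℕ.≤ n → M m s + U m s ≈ e s
      M+U≈e zero    s s≤n = +-identityˡ (e s)
      M+U≈e (suc m) s s≤n = begin-equality
        M (suc m) s + (P (U m) s + P (T m) s)
          ≈⟨ +-congʳ (M-suc m s) ⟩
        P (M m) s + P (F m) s + (P (U m) s + P (T m) s)
          ≈⟨ solve 4 (λ a b c d → a :+ b :+ (c :+ d) := (b :+ d) :+ (a :+ c)) refl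
               (P (M m) s) (P (F m) s) (P (U m) s) (P (T m) s) ⟩
        (P (F m) s + P (T m) s) + (P (M m) s + P (U m) s)
          ≈⟨ +-cong (P-+ (F m) (T m) s) (P-+ (M m) (U m) s) ⟨
        P (λ s → F m s + T m s) s + P (λ s → M m s + U m s) s
          ≈⟨ +-cong (P-cong (F+T≈1 m) s s≤n) (P-cong (M+U≈e m) s s≤n) ⟩
        P1 s + P e s
          ≈⟨ e-step s s≤n ⟨
        e s
          ∎

      -- Bounds on the tails.

      0≤T : ∀ m s → s ℕ.≤ n → 0# ≤ T m s
      0≤T zero    s s≤n = <⇒≤ 0<1
      0≤T (suc m) s s≤n = 0≤P (0≤T m) s s≤n

      0≤U : ∀ m s → s ℕ.≤ n → 0# ≤ U m s
      0≤U zero    s s≤n = 0≤e s s≤n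
      0≤U (suc m) s s≤n = 0≤+ (0≤P (0≤U m) s s≤n) (0≤T (suc m) s s≤n)

      T≤1 : ∀ m s → s ℕ.≤ n → T m s ≤ 1#
      T≤1 zero    s s≤n = ≤-refl
      T≤1 (suc m) s s≤n = ≤-trans (P-mono (T≤1 m) s s≤n) (P1≤1 s)

      T-suc≤P1 : ∀ m s → s ℕ.≤ n → T (suc m) s ≤ P1 s
      T-suc≤P1 m = P-mono (T≤1 m)

      U≤e : ∀ m s → s ℕ.≤ n → U m s ≤ e s
      U≤e zero    s s≤n = ≤-refl
      U≤e (suc m) s s≤n = begin
        P (U m) s + T (suc m) s   ≤⟨ +-mono-≤ (P-mono (U≤e m) s s≤n) (T-suc≤P1 m s s≤n) ⟩
        P e s + P1 s              ≈⟨ +-comm (P e s) (P1 s) ⟩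
        P1 s + P e s              ≈⟨ e-step s s≤n ⟨
        e s                       ∎

      Pe≤e : ∀ s → s ℕ.≤ n → P e s ≤ e s
      Pe≤e s s≤n = begin
        P e s           ≈⟨ +-identityˡ (P e s) ⟨
        0# + P e s      ≤⟨ +-mono-≤ (0≤P (λ _ _ → <⇒≤ 0<1) s s≤n) ≤-refl ⟩
        P1 s + P e s    ≈⟨ e-step s s≤n ⟨
        e s             ∎

      -- Markov's inequality with `e` for the mean. In the induction one copy of `T (suc m)` is paid
      -- for by `P1`, the other `m` copies by `P e`, and `e-step` adds the two up.
      mT≤e : ∀ m s → s ℕ.≤ n → fromℕ m * T m s ≤ e s
      mT≤e zero    s s≤n = ≤-trans (≈⇒≤ (zeroˡ 1#)) (0≤e s s≤n)
      mT≤e (suc m) s s≤n = begin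
        (1# + fromℕ m) * P (T m) s             ≈⟨ [1+x]*y≈y+x*y (fromℕ m) (P (T m) s) ⟩
        P (T m) s + fromℕ m * P (T m) s        ≈⟨ +-congˡ (P-* (fromℕ m) (T m) s) ⟨
        P (T m) s + P (λ s → fromℕ m * T m s) s
          ≤⟨ +-mono-≤ (T-suc≤P1 m s s≤n) (P-mono (mT≤e m) s s≤n) ⟩
        P1 s + P e s                           ≈⟨ e-step s s≤n ⟨
        e s                                    ∎

      -- In `(m + 1) * U (suc m)` the induction hypothesis takes care of `m` copies of `P (U m)`.
      -- What is left, `P (U m)` and `(m + 1) * T (suc m)`, is at most `e` each: this is the source
      -- of the factor 2.
      mU≤2Ke : ∀ m s → s ℕ.≤ n → fromℕ m * U m s ≤ (K + K) * e s
      mU≤2Ke zero    s s≤n =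
        ≤-trans (≈⇒≤ (zeroˡ (e s))) (0≤* (0≤+ 0≤K 0≤K) (0≤e s s≤n))
      mU≤2Ke (suc m) s s≤n = begin
        (1# + fromℕ m) * (P (U m) s + T (suc m) s)
          ≈⟨ distribˡ _ _ _ ⟩
        (1# + fromℕ m) * P (U m) s + fromℕ (suc m) * T (suc m) s
          ≈⟨ +-congʳ (trans ([1+x]*y≈y+x*y (fromℕ m) (P (U m) s)) (+-comm _ _)) ⟩
        fromℕ m * P (U m) s + P (U m) s + fromℕ (suc m) * T (suc m) s
          ≈⟨ +-assoc _ _ _ ⟩
        fromℕ m * P (U m) s + (P (U m) s + fromℕ (suc m) * T (suc m) s)
          ≈⟨ +-congʳ (P-* (fromℕ m) (U m) s) ⟨
        P (λ s → fromℕ m * U m s) s + (P (U m) s + fromℕ (suc m) * T (suc m) s)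
          ≤⟨ +-mono-≤ (P-mono (mU≤2Ke m) s s≤n)
               (+-mono-≤ (P-mono (U≤e m) s s≤n) (mT≤e (suc m) s s≤n)) ⟩
        P (λ s → (K + K) * e s) s + (P e s + e s)
          ≈⟨ +-congʳ (P-* (K + K) e s) ⟩
        (K + K) * P e s + (P e s + e s)
          ≤⟨ +-monoʳ-≤ _ (+-mono-≤ (Pe≤e s s≤n) ≤-refl) ⟩
        (K + K) * P e s + (e s + e s)
          -- The bound of `e` by `K * P1` turns the two surplus copies of `e` into `(K + K) * P1`,
          -- the term that `e-step` asks for next to `(K + K) * P e`.
          ≤⟨ +-monoʳ-≤ _ (+-mono-≤ (e≤K s s≤n) (e≤K s s≤n)) ⟩
        (K + K) * P e s + (K * P1 s + K * P1 s)
          ≈⟨ solve 3 (λ K a b → (K :+ K) :* a :+ (K :* b :+ K :* b) := (K :+ K) :* (b :+ a))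
               refl K (P e s) (P1 s) ⟩
        (K + K) * (P1 s + P e s)
          ≈⟨ *-congˡ (e-step s s≤n) ⟨
        (K + K) * e s
          ∎

      isExpectation : ∀ s → s ℕ.≤ n → IsExpectation ℝ (λ t → f t s) (e s)
      isExpectation s s≤n = record
        { finite = ⟶-from-O[1/m] (λ m → T m s) (e s)
            (λ m → F+T≈1 m s s≤n) (λ m → 0≤T m s s≤n) (λ m → mT≤e m s s≤n)
        ; mean = ⟶-from-O[1/m] (λ m → U m s) ((K + K) * e s)
            (λ m → M+U≈e m s s≤n) (λ m → 0≤U m s s≤n) (λ m → mU≤2Ke m s s≤n)
        }


-- The pile game: choice sequences sorted by their first choice.

module PileGame {c ℓ₁ ℓ₂ ℓ₃} (ℝ : RealField c ℓ₁ ℓ₂ ℓ₃) where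
  open RealField ℝ
  open RealFieldProperties ℝ
  open AbsorbedWalk ℝ
  open RingProperties ring
  open ≤-Reasoning
  open SemiringSolver (CommutativeRing.commutativeSemiring commutativeRing)
    using (solve; _:=_; _:+_; _:*_)

  module _ (p : Carrier) where

    q : Carrier
    q = 1# - p

    p+q≈1 : p + q ≈ 1#
    p+q≈1 = x+[y-x]≈y p 1#

    x≈[p+q]*x : ∀ x → x ≈ (p + q) * x
    x≈[p+q]*x x = trans (sym (*-identityˡ x)) (*-congʳ (sym p+q≈1))

    totalWeight : ∀ {t} → List (Vec Choice t) → Carrier
    totalWeight ωs = foldr _+_ 0# (map (weight ℝ p) ωs)

    totalWeight-++ : ∀ {t} (xs ys : List (Vec Choice t)) →
      totalWeight (xs ++ ys) ≈ totalWeight xs + totalWeight ys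
    totalWeight-++ []       ys = sym (+-identityˡ _)
    totalWeight-++ (x ∷ xs) ys = trans (+-congˡ (totalWeight-++ xs ys)) (sym (+-assoc _ _ _))

    totalWeight-∷ : ∀ {t} r (xs : List (Vec Choice t)) →
      totalWeight (map (r ∷_) xs) ≈ choiceProbability ℝ p r * totalWeight xs
    totalWeight-∷ r []       = sym (zeroʳ _)
    totalWeight-∷ r (x ∷ xs) = trans (+-congˡ (totalWeight-∷ r xs)) (sym (distribˡ _ _ _))

    -- At `n` the game is over at turn 0, so every nonempty sequence is too long.
    winning-∷-≡ : ∀ {n s} → s ≡ n → ∀ r {t} (ωs : List (Vec Choice t)) →
      filter (endsAfter? n s) (map (r ∷_) ωs) ≡ []
    winning-∷-≡ {n} {s} s≡n r ωs = filter-none (endsAfter? n s)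
      (All.map⁺ (All.universal (λ _ (s≢n , _) → s≢n s≡n) ωs))

    -- With `s ≢ n` given, the condition on `r ∷ ω` reduces to the one on `ω` from the next
    -- position, so the filter moves inside the map.
    winning-∷-≢ : ∀ {n s} → s ≢ n → ∀ r {t} (ωs : List (Vec Choice t)) →
      filter (endsAfter? n s) (map (r ∷_) ωs) ≡
        map (r ∷_) (filter (endsAfter? n (move s r)) ωs)
    winning-∷-≢ {n} {s} s≢n r ωs = ≡.trans
      (filter-map (endsAfter? n s) (r ∷_) ωs)
      (≡.cong (map (r ∷_))
        (filter-≐ (λ ω → endsAfter? n s (r ∷ ω)) (endsAfter? n (move s r))
          (proj₂ , (s≢n ,_)) ωs))

    module _ (n : ℕ) where

      f : ℕ → ℕ → Carrier
      f t s = ℙ[X≡_] ℝ t p n s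

      f-split : ∀ t s → f (suc t) s ≈
        totalWeight (filter (endsAfter? n s) (map (add ∷_) (choiceSequences t))) +
        totalWeight (filter (endsAfter? n s) (map (remove ∷_) (choiceSequences t)))
      f-split t s = trans
        (reflexive (≡.cong totalWeight (filter-++ (endsAfter? n s) ωs₁ ωs₂)))
        (totalWeight-++ (filter (endsAfter? n s) ωs₁) (filter (endsAfter? n s) ωs₂))
        where
        ωs₁ ωs₂ : List (Vec Choice (suc t))
        ωs₁ = map (add ∷_) (choiceSequences t)
        ωs₂ = map (remove ∷_) (choiceSequences t)

      f-suc-≡ : ∀ t {s} → s ≡ n → f (suc t) s ≈ 0#
      f-suc-≡ t {s} s≡n = trans (f-split t s) (trans
        (+-cong (reflexive (≡.cong totalWeight (winning-∷-≡ s≡n add (choiceSequences t))))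
                (reflexive (≡.cong totalWeight (winning-∷-≡ s≡n remove (choiceSequences t)))))
        (+-identityʳ 0#))

      -- Total probability over the first choice; independence enters as the multiplicativity of
      -- `weight`.
      f-suc-≢ : ∀ t {s} → s ≢ n → f (suc t) s ≈ p * f t (suc s) + q * f t (pred s)
      f-suc-≢ t {s} s≢n = trans (f-split t s) (+-cong (first add) (first remove))
        where
        first : ∀ r → totalWeight (filter (endsAfter? n s) (map (r ∷_) (choiceSequences t))) ≈
          choiceProbability ℝ p r * f t (move s r)
        first r = trans
          (reflexive (≡.cong totalWeight (winning-∷-≢ s≢n r (choiceSequences t))))
          (totalWeight-∷ r (filter (endsAfter? n (move s r)) (choiceSequences t)))

      f-zero-≡ : ∀ {s} → s ≡ n → f 0 s ≈ 1#
      f-zero-≡ {s} s≡n = trans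
        (reflexive (≡.cong totalWeight (filter-accept (endsAfter? n s) {[]} {[]} s≡n)))
        (+-identityʳ 1#)

      f-zero-≢ : ∀ {s} → s ≢ n → f 0 s ≈ 0#
      f-zero-≢ {s} s≢n =
        reflexive (≡.cong totalWeight (filter-reject (endsAfter? n s) {[]} {[]} s≢n))

    -- From the first-step equations to the expectation.

    module _ (0<p : 0# < p) (p≤1 : p ≤ 1#) where

      0≤q : 0# ≤ q
      0≤q = x≤y⇒0≤y-x p≤1

      -- Separates probability from algebra: a candidate `e` enters only through its recurrence and
      -- its value at `n`. These make it decreasing, hence nonnegative up to `n` and bounded by
      -- `e 0`, which serves as `K`.
      isExpectation : ∀ n (e : ℕ → Carrier) → e n ≈ 0# →
        (∀ s → e s ≈ 1# + (p * e (suc s) + q * e (pred s))) →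
        ∀ s → s ℕ.≤ n → IsExpectation ℝ (λ t → f n t s) (e s)
      isExpectation n e en≈0 e-rec =
        Expectation.isExpectation (f n) f-zero f-suc e e-step 0≤e (e 0) (0≤e 0 z≤n) e≤e₀*P1
        where
        open Step p q p+q≈1 (<⇒≤ 0<p) 0≤q n

        -- Mutual induction on `s`, started by `pred 0 = 0`. Given `e s ≤ e (pred s)`, the
        -- recurrence yields `q * e s + p * e (suc s) ≤ e s = q * e s + p * e s`; then `q * e
        -- s` and the positive factor `p` cancel.
        e-suc≤e : ∀ s → e (suc s) ≤ e s
        e-pred : ∀ s → e s ≤ e (pred s)

        e-suc≤e s = *-cancelˡ-≤ 0<p (+-cancelˡ-≤ (q * e s) (begin
          q * e s + p * e (suc s)               ≤⟨ +-mono-≤ (*-monoʳ-≤ 0≤q (e-pred s)) ≤-refl ⟩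
          q * e (pred s) + p * e (suc s)        ≈⟨ +-comm _ _ ⟩
          p * e (suc s) + q * e (pred s)        ≈⟨ +-identityˡ _ ⟨
          0# + (p * e (suc s) + q * e (pred s)) ≤⟨ +-mono-≤ (<⇒≤ 0<1) ≤-refl ⟩
          1# + (p * e (suc s) + q * e (pred s)) ≈⟨ e-rec s ⟨
          e s                                   ≈⟨ x≈[p+q]*x (e s) ⟩
          (p + q) * e s                         ≈⟨ distribʳ _ _ _ ⟩
          p * e s + q * e s                     ≈⟨ +-comm _ _ ⟩
          q * e s + p * e s                     ∎))

        e-pred zero    = ≤-refl
        e-pred (suc s) = e-suc≤e s

        e-antitone : ∀ {s t} → s ℕ.≤′ t → e t ≤ e s
        e-antitone ℕ.≤′-refl            = ≤-refl
        e-antitone (ℕ.≤′-step {t} s≤t)  = ≤-trans (e-suc≤e t) (e-antitone s≤t)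

        0≤e : ∀ s → s ℕ.≤ n → 0# ≤ e s
        0≤e s s≤n = ≤-trans (≈⇒≤ (sym en≈0)) (e-antitone (ℕ.≤⇒≤′ s≤n))

        f-zero : ∀ s → f n 0 s + P1 s ≈ 1#
        f-zero s with s ℕ.≟ n
        ... | yes s≡n = trans (+-congʳ (f-zero-≡ n s≡n)) (+-identityʳ 1#)
        ... | no  s≢n = trans (+-cong (f-zero-≢ n s≢n) p*1+q*1≈1) (+-identityˡ 1#)

        f-suc : ∀ t s → f n (suc t) s ≈ P (f n t) s
        f-suc t s with s ℕ.≟ n
        ... | yes s≡n = f-suc-≡ n t s≡n
        ... | no  s≢n = f-suc-≢ n t s≢n

        e-step : ∀ s → s ℕ.≤ n → e s ≈ P1 s + P e s
        e-step s _ with s ℕ.≟ n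
        ... | yes ≡.refl = trans en≈0 (sym (+-identityʳ 0#))
        ... | no  _      = trans (e-rec s) (+-congʳ (sym p*1+q*1≈1))

        e≤e₀*P1 : ∀ s → s ℕ.≤ n → e s ≤ e 0 * P1 s
        e≤e₀*P1 s _ with s ℕ.≟ n
        ... | yes ≡.refl = ≈⇒≤ (trans en≈0 (sym (zeroʳ (e 0))))
        ... | no  _      = begin
          e s                      ≤⟨ e-antitone (ℕ.≤⇒≤′ z≤n) ⟩
          e 0                      ≈⟨ *-identityʳ (e 0) ⟨
          e 0 * 1#                 ≈⟨ *-congˡ p*1+q*1≈1 ⟨
          e 0 * (p * 1# + q * 1#)  ∎

    -- The closed form and its recurrence.

    A : Carrier
    A = 2# * p - 1#

    -- `A` is the drift `p - q` of one turn. Stated without subtraction, this lets the recurrence of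
    -- `φ` be checked by semiring identities.
    A+q≈p : A + q ≈ p
    A+q≈p = begin-equality
      2# * p - 1# + (1# - p)
        ≈⟨ +-congʳ (+-congʳ 2p≈p+p) ⟩
      p + p - 1# + (1# - p)
        ≈⟨ solve 4 (λ p -p 1′ -1′ →
             p :+ p :+ -1′ :+ (1′ :+ -p) := p :+ ((p :+ -p) :+ (1′ :+ -1′)))
             refl p (- p) 1# (- 1#) ⟩
      p + ((p - p) + (1# - 1#))
        ≈⟨ +-congˡ (+-cong (-‿inverseʳ p) (-‿inverseʳ 1#)) ⟩
      p + (0# + 0#)
        ≈⟨ trans (+-congˡ (+-identityʳ 0#)) (+-identityʳ p) ⟩
      p ∎
      where
      2p≈p+p : 2# * p ≈ p + p
      2p≈p+p = trans ([1+x]*y≈y+x*y (1# + 0#) p)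
        (+-congˡ (trans (*-congʳ (+-identityʳ 1#)) (*-identityˡ p)))

    module ClosedForm (r : Carrier) (r*p≈q : r * p ≈ q) where

      -- The linear term is a particular solution of the recurrence below, and `r ^ s` is harmonic
      -- away from 0. The coefficient `q` of `r ^ s` is the one for which the equation also holds at
      -- 0, where the walk may stay.
      φ : ℕ → Carrier
      φ s = A * fromℕ s + q * r ^ s

      -- Away from 0, one turn changes `s` by `A` on average, so the linear term gains `A * A`,
      -- while `r * p ≈ q` keeps the average of `r ^ s` unchanged.
      φ-rec : ∀ s → φ s + A * A ≈ p * φ (suc s) + q * φ (pred s)
      φ-rec zero = begin-equality
        φ 0 + A * A
          ≈⟨ +-congʳ (trans φ₀≈q (x≈[p+q]*x q)) ⟩
        (p + q) * q + A * A
          ≈⟨ +-congʳ (*-congʳ (+-congʳ A+q≈p)) ⟨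
        (A + q + q) * q + A * A
          ≈⟨ solve 2 (λ A q →
               (A :+ q :+ q) :* q :+ A :* A := (A :+ q) :* A :+ q :* q :+ q :* q)
               refl A q ⟩
        (A + q) * A + q * q + q * q
          ≈⟨ +-congʳ (+-cong (*-congʳ A+q≈p) (*-congˡ (sym r*p≈q))) ⟩
        p * A + q * (r * p) + q * q
          ≈⟨ solve 4 (λ A p q r →
               p :* A :+ q :* (r :* p) :+ q :* q := p :* (A :+ q :* r) :+ q :* q)
               refl A p q r ⟩
        p * (A + q * r) + q * q
          ≈⟨ +-cong (*-congˡ φ₁≈A+qr) (*-congˡ φ₀≈q) ⟨
        p * φ 1 + q * φ 0 ∎
        where
        φ₀≈q : φ 0 ≈ q
        φ₀≈q = trans (+-cong (zeroʳ A) (*-identityʳ q)) (+-identityˡ q)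

        φ₁≈A+qr : φ 1 ≈ A + q * r
        φ₁≈A+qr = +-cong (trans (*-congˡ (+-identityʳ 1#)) (*-identityʳ A))
                         (*-congˡ (*-identityʳ r))
      φ-rec (suc k) = begin-equality
        φ (suc k) + A * A
          ≈⟨ +-congʳ (x≈[p+q]*x (φ (suc k))) ⟩
        (p + q) * (A * (1# + K) + q * (r * R)) + A * A
          ≈⟨ +-congʳ (*-congˡ (+-congʳ (A*suc K))) ⟩
        (p + q) * (A + A * K + q * (r * R)) + A * A
          ≈⟨ solve 6 (λ p q A K r R →
               (p :+ q) :* (A :+ A :* K :+ q :* (r :* R)) :+ A :* A :=
               p :* (A :+ A :* K) :+ q :* (A :* K) :+ (A :+ q) :* A
                 :+ q :* q :* (r :* R) :+ q :* (r :* p) :* R)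
               refl p q A K r R ⟩
        p * (A + A * K) + q * (A * K) + (A + q) * A + q * q * (r * R) + q * (r * p) * R
          -- The exchange of `q` and `r * p` goes both ways: in one term it raises the power of `r`
          -- to `k + 2`, with a factor `p`, and in the other it lowers the power to `k`, with a
          -- factor `q`. These are the two neighbours of `suc k`.
          ≈⟨ +-cong (+-cong (+-congˡ (*-congʳ A+q≈p)) (*-congʳ (*-congˡ (sym r*p≈q))))
                    (*-congʳ (*-congˡ r*p≈q)) ⟩
        p * (A + A * K) + q * (A * K) + p * A + q * (r * p) * (r * R) + q * q * R
          ≈⟨ solve 6 (λ p q A K r R →
               p :* (A :+ A :* K) :+ q :* (A :* K) :+ p :* A
                 :+ q :* (r :* p) :* (r :* R) :+ q :* q :* R :=
               p :* (A :+ (A :+ A :* K) :+ q :* (r :* (r :* R))) :+ q :* (A :* K :+ q :* R))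
               refl p q A K r R ⟩
        p * (A + (A + A * K) + q * (r * (r * R))) + q * (A * K + q * R)
          ≈⟨ +-congʳ (*-congˡ (+-congʳ A*suc²)) ⟨
        p * φ (suc (suc k)) + q * φ k ∎
        where
        K R : Carrier
        K = fromℕ k
        R = r ^ k

        A*suc : ∀ x → A * (1# + x) ≈ A + A * x
        A*suc x = trans (distribˡ A 1# x) (+-congʳ (*-identityʳ A))

        A*suc² : A * (1# + (1# + K)) ≈ A + (A + A * K)
        A*suc² = trans (A*suc (1# + K)) (+-congˡ (A*suc K))

      module _ (i : Carrier) (A*A*i≈1 : A * A * i ≈ 1#) (n : ℕ) where

        e : ℕ → Carrier
        e s = (φ n - φ s) * i

        e-n : e n ≈ 0#
        e-n = trans (*-congʳ (-‿inverseʳ (φ n))) (zeroˡ i)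

        -- As `p + q` is 1, averaging leaves the constant `φ n` alone. Subtracting `φ` turns its
        -- gain `A * A` per turn into a loss, which `i` scales to 1.
        e-rec : ∀ s → e s ≈ 1# + (p * e (suc s) + q * e (pred s))
        e-rec s = begin-equality
          (φ n - φ s) * i
            ≈⟨ *-congʳ φn-φs ⟩
          (A * A + (p * (φ n - φ (suc s)) + q * (φ n - φ (pred s)))) * i
            ≈⟨ solve 6 (λ a i p q x y →
                 (a :+ (p :* x :+ q :* y)) :* i := a :* i :+ (p :* (x :* i) :+ q :* (y :* i)))
                 refl (A * A) i p q (φ n - φ (suc s)) (φ n - φ (pred s)) ⟩
          A * A * i + (p * e (suc s) + q * e (pred s))
            ≈⟨ +-congʳ A*A*i≈1 ⟩
          1# + (p * e (suc s) + q * e (pred s)) ∎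
          where
          a+[p[x-y]+q[x-z]] : ∀ a x y z →
            a + (p * (x - y) + q * (x - z)) ≈ x + (a - (p * y + q * z))
          a+[p[x-y]+q[x-z]] a x y z = begin-equality
            a + (p * (x - y) + q * (x - z))
              ≈⟨ +-congˡ (+-cong (*-distribˡ-- p x y) (*-distribˡ-- q x z)) ⟩
            a + ((p * x - p * y) + (q * x - q * z))
              ≈⟨ solve 6 (λ a p q x -py -qz →
                   a :+ ((p :* x :+ -py) :+ (q :* x :+ -qz)) := (p :+ q) :* x :+ (a :+ (-py :+ -qz)))
                   refl a p q x (- (p * y)) (- (q * z)) ⟩
            (p + q) * x + (a + (- (p * y) - q * z))
              ≈⟨ +-cong (trans (*-congʳ p+q≈1) (*-identityˡ x)) (+-congˡ (-‿+-comm _ _)) ⟩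
            x + (a - (p * y + q * z)) ∎

          φn-φs : φ n - φ s ≈ A * A + (p * (φ n - φ (suc s)) + q * (φ n - φ (pred s)))
          φn-φs = sym (begin-equality
            A * A + (p * (φ n - φ (suc s)) + q * (φ n - φ (pred s)))
              ≈⟨ a+[p[x-y]+q[x-z]] (A * A) (φ n) (φ (suc s)) (φ (pred s)) ⟩
            φ n + (A * A - (p * φ (suc s) + q * φ (pred s)))
              ≈⟨ +-congˡ (+-congˡ (-‿cong (φ-rec s))) ⟨
            φ n + (A * A - (φ s + A * A))
              ≈⟨ +-congˡ (+-congˡ (-‿+-comm (φ s) (A * A))) ⟨
            φ n + (A * A + (- φ s - A * A))
              ≈⟨ +-congˡ (x+[y-x]≈y (A * A) (- φ s)) ⟩
            φ n - φ s ∎)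

proposition7 : ∀ {c ℓ₁ ℓ₂ ℓ₃} (ℝ : RealField c ℓ₁ ℓ₂ ℓ₃) →
    let open RealField ℝ in
    (p : Carrier) (0<p : 0# < p) (p≤1 : p ≤ 1#) (p≠½ : p # ½ ℝ) →
    (n s : ℕ) → s ℕ.≤ n →
    let q = 1# - p
        q/p = q / p [ 0<⇒#0 ℝ 0<p ]
    in
    IsExpectation ℝ (λ t → ℙ[X≡_] ℝ t p n s)
      (((2# * p - 1#) * fromℕ n + q * q/p ^ n
          - ((2# * p - 1#) * fromℕ s + q * q/p ^ s))
        / (2# * p - 1#) ^ 2 [ [2p-1]²#0 ℝ p≠½ ])
-- The formula of the statement unfolds to the `e` of `ClosedForm` with `r = q p * p⁻¹` and `i` the
-- inverse attached to the denominator.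
proposition7 ℝ p 0<p p≤1 p≠½ n =
  isExpectation p 0<p p≤1 n (e i A²*i≈1 n) (e-n i A²*i≈1 n) (e-rec i A²*i≈1 n)
  where
  open RealField ℝ
  open RealFieldProperties ℝ
  open HeytingProperties heytingCommutativeRing using (x-0≈x)
  open PileGame ℝ
  open ≤-Reasoning

  -- These are the inverses used by `_/_[_]`. They invert `p - 0#` and `A p ^ 2 - 0#`, so `x-0≈x`
  -- has to remove the zero before anything cancels.
  p⁻¹ i : Carrier
  p⁻¹ = proj₁ (#⇒invertible (0<⇒#0 ℝ 0<p))
  i = proj₁ (#⇒invertible ([2p-1]²#0 ℝ p≠½))

  q/p*p≈q : q p * p⁻¹ * p ≈ q p
  q/p*p≈q = begin-equality
    q p * p⁻¹ * p           ≈⟨ *-assoc (q p) p⁻¹ p ⟩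
    q p * (p⁻¹ * p)         ≈⟨ *-congˡ (*-congˡ (x-0≈x p)) ⟨
    q p * (p⁻¹ * (p - 0#))  ≈⟨ *-congˡ (proj₁ (proj₂ (#⇒invertible (0<⇒#0 ℝ 0<p)))) ⟩
    q p * 1#                ≈⟨ *-identityʳ (q p) ⟩
    q p                     ∎

  A²*i≈1 : A p * A p * i ≈ 1#
  A²*i≈1 = begin-equality
    A p * A p * i             ≈⟨ *-congʳ (*-congˡ (*-identityʳ (A p))) ⟨
    A p ^ 2 * i               ≈⟨ *-congʳ (x-0≈x (A p ^ 2)) ⟨
    (A p ^ 2 - 0#) * i        ≈⟨ proj₂ (proj₂ (#⇒invertible ([2p-1]²#0 ℝ p≠½))) ⟩
    1#                        ∎

  open ClosedForm p (q p * p⁻¹) q/p*p≈q
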